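{- Let $\vdash P::\Gamma_1\parallel\cdots\parallel\Gamma_n$ in $\pi$MLL. Then $\mathsf{dis}(P)=P_1\parallel\cdots\parallel P_n$ for some processes $P_1,\ldots,P_n$ such that $\vdash P_i::\Gamma_i$ for each $i\in\{1,\ldots,n\}$.
   Context: **$\pi$MLL.** Names $x,y,z,\ldots$ come from an infinite set. Types: $A,B::=A\otimes B\mid A\wp B\mid1\mid\bot$ ($\wp$ is "par"), with duality the involution given by $(A\otimes B)^\perp=A^\perp\wp B^\perp$, $(A\wp B)^\perp=A^\perp\otimes B^\perp$, $1^\perp=\bot$, $\bot^\perp=1$. Processes: $P,Q::=x[y].P\mid x(y).P\mid x[].P\mid x().P\mid(\nu xy)P\mid P\parallel Q\mid\mathbf 0$, with $y$ bound in $x[y].P$ and $x(y).P$, and $x,y$ bound in $(\nu xy)P$; $\mathrm{fn}(P)$ is the set of free names. Environments $\Gamma$ are finite unordered lists of distinct names with types; hyperenvironments $\mathcal G=\Gamma_1\parallel\cdots\parallel\Gamma_n$ are finite multisets of environments with all names distinct; $\emptyset$ is the hyperenvironment with no environments ("," binds tighter than $\parallel$). Typing rules (premises $\Rightarrow$ conclusion): $\vdash P::\mathcal G\parallel\Gamma,x:A\parallel\Delta,y:A^\perp\Rightarrow\ \vdash(\nu xy)P::\mathcal G\parallel\Gamma,\Delta$; $\vdash P::\mathcal G$ and $\vdash Q::\mathcal H\Rightarrow\ \vdash P\parallel Q::\mathcal G\parallel\mathcal H$; $\vdash\mathbf 0::\emptyset$; $\vdash P::\Gamma,y:A\parallel\Delta,x:B\Rightarrow\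 \vdash x[y].P::\Gamma,\Delta,x:A\otimes B$; $\vdash P::\emptyset\Rightarrow\ \vdash x[].P::x:1$; $\vdash P::\Gamma,y:A,x:B\Rightarrow\ \vdash x(y).P::\Gamma,x:A\wp B$; $\vdash P::\Gamma\Rightarrow\ \vdash x().P::\Gamma,x:\bot$. **Disentanglement.** $\mathsf{dis}(P)$ is the process obtained from a well-typed $P$ by recursively rewriting it with the following laws, read left to right, until no longer possible: $P\parallel\mathbf 0\mapsto P$; $(\nu xy)(P\parallel Q)\mapsto(\nu xy)P\parallel Q$ if $x,y\notin\mathrm{fn}(Q)$; $(\nu xy)(P\parallel Q)\mapsto P\parallel(\nu xy)Q$ if $x,y\notin\mathrm{fn}(P)$. Parallel compositions are read modulo associativity, commutativity and unit $\mathbf 0$ (the empty parallel composition, $n=0$, is $\mathbf 0$). Equivalently: $\mathsf{dis}(\pi.P)=\pi.\mathsf{dis}(P)$; $\mathsf{dis}(\mathbf 0)=\mathbf 0$; $\mathsf{dis}(P\parallel Q)=\mathsf{dis}(P)\parallel\mathsf{dis}(Q)$; and if $\mathsf{dis}(P)=P_1\parallel\cdots\parallel P_n$ with $x\in\mathrm{fn}(P_i)$, $y\in\mathrm{fn}(P_j)$, then $\mathsf{dis}((\nu xy)P)$ is $(\nu xy)(P_i\parallel P_j)$ in parallel with all $P_k$, $k\neq i,j$. -}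

module Defs where

open import Data.List.Base using (List; []; _∷_; [_]; _++_; map; concat; foldr)
open import Data.List.Relation.Unary.Unique.Propositional using (Unique)
import Data.List.Relation.Binary.Permutation.Propositional as EnvPerm
import Data.List.Relation.Binary.Permutation.Setoid as SetoidPerm
open import Data.Empty using () renaming (⊥ to Empty)
open import Data.Product.Base using (_×_; _,_; proj₁; ∃-syntax)
open import Data.Sum.Base using (_⊎_)
open import Level using (0ℓ)
open import Relation.Binary.Core using (Rel)
open import Relation.Binary.Construct.Closure.Equivalence using (EqClosure)
open import Relation.Binary.Construct.Closure.ReflexiveTransitive using (Star)
open import Relation.Binary.PropositionalEquality.Core using (_≡_; _≢_)
open import Relation.Binary.Rewriting using (IsNormalForm)
open import Relation.Nullary.Negation.Core using (¬_)

infixr 7 _⊗_ _⅋_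
infix  9 _^⊥

data Type : Set where
  _⊗_ _⅋_ : Type → Type → Type
  𝟏 ⊥     : Type

_^⊥ : Type → Type
(A ⊗ B) ^⊥ = A ^⊥ ⅋ B ^⊥
(A ⅋ B) ^⊥ = A ^⊥ ⊗ B ^⊥
𝟏       ^⊥ = ⊥
⊥       ^⊥ = 𝟏

module πMLL (Name : Set) where

  infixr 6 _[_]∙_ _⟨_⟩∙_ _[]∙_ _⟨⟩∙_
  infixr 5 _∥_

  -- Raw terms, not identified up to α-renaming. The input x(y).P and x().P are
  -- written x ⟨ y ⟩∙ P and x ⟨⟩∙ P. Nothing below ever needs to rename a binder:
  -- there is no substitution, and the laws of disentanglement only shrink the
  -- scope of a restriction.
  data Proc : Set where
    _[_]∙_ : Name → Name → Proc → Proc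
    _⟨_⟩∙_ : Name → Name → Proc → Proc
    _[]∙_  : Name → Proc → Proc
    _⟨⟩∙_  : Name → Proc → Proc
    ν      : Name → Name → Proc → Proc
    _∥_    : Proc → Proc → Proc
    𝟎      : Proc

  infix 4 _∈fn_ _∉fn_

  _∈fn_ : Name → Proc → Set
  z ∈fn (x [ y ]∙ P) = z ≡ x ⊎ (z ≢ y × z ∈fn P)
  z ∈fn (x ⟨ y ⟩∙ P) = z ≡ x ⊎ (z ≢ y × z ∈fn P)
  z ∈fn (x []∙ P)    = z ≡ x ⊎ z ∈fn P
  z ∈fn (x ⟨⟩∙ P)    = z ≡ x ⊎ z ∈fn P
  z ∈fn (ν x y P)    = z ≢ x × z ≢ y × z ∈fn P
  z ∈fn (P ∥ Q)      = z ∈fn P ⊎ z ∈fn Q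
  z ∈fn 𝟎            = Empty

  _∉fn_ : Name → Proc → Set
  z ∉fn P = ¬ (z ∈fn P)

  -- Environments and hyperenvironments are represented by lists; _≃_ is the
  -- equality of the unordered objects they stand for, that is, permutation of the
  -- environments and of the entries inside each environment.
  Env : Set
  Env = List (Name × Type)

  HyperEnv : Set
  HyperEnv = List Env

  open SetoidPerm (EnvPerm.↭-setoid {A = Name × Type}) public
    using () renaming (_↭_ to infix 4 _≃_)

  Distinct : HyperEnv → Set
  Distinct 𝒢 = Unique (map proj₁ (concat 𝒢))

  infix 3 ⊢_∷∷_

  -- Distinct is demanded only where a rule could break it (t-par and t-bot);
  -- the other rules preserve it, so every derivable hyperenvironment is distinct.
  data ⊢_∷∷_ : Proc → HyperEnv → Set where
    t-cut  : ∀ {x y A P Γ Δ 𝒢} →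
             ⊢ P ∷∷ ((x , A) ∷ Γ) ∷ ((y , A ^⊥) ∷ Δ) ∷ 𝒢 →
             ⊢ ν x y P ∷∷ (Γ ++ Δ) ∷ 𝒢
    t-par  : ∀ {P Q 𝒢 ℋ} →
             ⊢ P ∷∷ 𝒢 → ⊢ Q ∷∷ ℋ → Distinct (𝒢 ++ ℋ) →
             ⊢ P ∥ Q ∷∷ 𝒢 ++ ℋ
    t-nil  : ⊢ 𝟎 ∷∷ []
    t-⊗    : ∀ {x y A B P Γ Δ} →
             ⊢ P ∷∷ ((y , A) ∷ Γ) ∷ ((x , B) ∷ Δ) ∷ [] →
             ⊢ x [ y ]∙ P ∷∷ [ (x , A ⊗ B) ∷ (Γ ++ Δ) ]
    t-one  : ∀ {x P} →
             ⊢ P ∷∷ [] →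
             ⊢ x []∙ P ∷∷ [ [ (x , 𝟏) ] ]
    t-⅋    : ∀ {x y A B P Γ} →
             ⊢ P ∷∷ [ (y , A) ∷ (x , B) ∷ Γ ] →
             ⊢ x ⟨ y ⟩∙ P ∷∷ [ (x , A ⅋ B) ∷ Γ ]
    t-bot  : ∀ {x P Γ} →
             ⊢ P ∷∷ [ Γ ] → Distinct [ (x , ⊥) ∷ Γ ] →
             ⊢ x ⟨⟩∙ P ∷∷ [ (x , ⊥) ∷ Γ ]
    t-exch : ∀ {P 𝒢 ℋ} → 𝒢 ≃ ℋ → ⊢ P ∷∷ 𝒢 → ⊢ P ∷∷ ℋ

  data Compatible (R : Rel Proc 0ℓ) : Rel Proc 0ℓ where
    here : ∀ {P Q} → R P Q → Compatible R P Q
    out  : ∀ {x y P Q} → Compatible R P Q → Compatible R (x [ y ]∙ P) (x [ y ]∙ Q)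
    inp  : ∀ {x y P Q} → Compatible R P Q → Compatible R (x ⟨ y ⟩∙ P) (x ⟨ y ⟩∙ Q)
    out₀ : ∀ {x P Q} → Compatible R P Q → Compatible R (x []∙ P) (x []∙ Q)
    inp₀ : ∀ {x P Q} → Compatible R P Q → Compatible R (x ⟨⟩∙ P) (x ⟨⟩∙ Q)
    res  : ∀ {x y P Q} → Compatible R P Q → Compatible R (ν x y P) (ν x y Q)
    parˡ : ∀ {P P′ Q} → Compatible R P P′ → Compatible R (P ∥ Q) (P′ ∥ Q)
    parʳ : ∀ {P Q Q′} → Compatible R Q Q′ → Compatible R (P ∥ Q) (P ∥ Q′)

  data AC : Rel Proc 0ℓ where
    assoc : ∀ {P Q R} → AC ((P ∥ Q) ∥ R) (P ∥ (Q ∥ R))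
    comm  : ∀ {P Q} → AC (P ∥ Q) (Q ∥ P)

  data ACU : Rel Proc 0ℓ where
    ac   : ∀ {P Q} → AC P Q → ACU P Q
    unit : ∀ {P} → ACU (P ∥ 𝟎) P

  infix 4 _≈ᵃᶜ_ _≈_ _⟶_

  _≈ᵃᶜ_ : Rel Proc 0ℓ
  _≈ᵃᶜ_ = EqClosure (Compatible AC)

  _≈_ : Rel Proc 0ℓ
  _≈_ = EqClosure (Compatible ACU)

  data Law : Rel Proc 0ℓ where
    unit   : ∀ {P} → Law (P ∥ 𝟎) P
    scopeˡ : ∀ {x y P Q} → x ∉fn Q → y ∉fn Q → Law (ν x y (P ∥ Q)) (ν x y P ∥ Q)
    scopeʳ : ∀ {x y P Q} → x ∉fn P → y ∉fn P → Law (ν x y (P ∥ Q)) (P ∥ ν x y Q)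

  -- The laws apply anywhere in a term, modulo associativity and commutativity.
  -- The unit is a directed law here rather than part of the equivalence: modulo
  -- P ∥ 𝟎 ≈ P every process would have a redex and no rewriting would ever stop.
  _⟶_ : Rel Proc 0ℓ
  P ⟶ Q = ∃[ P′ ] ∃[ Q′ ] (P ≈ᵃᶜ P′ × Compatible Law P′ Q′ × Q′ ≈ᵃᶜ Q)

  -- Q is (a representative, modulo _≈_, of) dis(P).
  Dis : Proc → Proc → Set
  Dis P Q = Star _⟶_ P Q × IsNormalForm _⟶_ Q

  ∏ : List Proc → Proc
  ∏ = foldr _∥_ 𝟎

{-# OPTIONS --safe #-}
-- A typed process reduces by the laws to a product of components, one per environment, by
-- induction on its derivation: in the case of a cut, the components other than the two holding
-- the restricted names do not mention them, because the free names of a typed process are the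
-- names of its hyperenvironment, so scopeˡ expels them. Each law preserves typing, hence the
-- same result applies to any normal form of P, where the reduction is necessarily empty.
-- A product of components is normal since every restriction in it has a body typed by two
-- environments, and expelling a factor other than 𝟎 would need a third.

module Submission where

open import Data.List.Base using (List; []; _∷_; [_]; _++_; map; concat)
open import Data.List.Membership.Propositional using (_∈_; _∉_)
open import Data.List.Membership.Propositional.Properties using (∈-++⁺ˡ; ∈-++⁺ʳ; ∈-++⁻)
import Data.List.Membership.Setoid.Properties as SetoidMembershipₚ
open import Data.List.Properties using (map-++; concat-++; ++-conicalˡ; ++-conicalʳ; ++-identityʳ)
open import Data.List.Relation.Binary.Permutation.Propositional as ↭
  using (_↭_; ↭-setoid; ↭-sym; ↭-trans)
import Data.List.Relation.Binary.Permutation.Propositional.Properties as ↭ₚ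
import Data.List.Relation.Binary.Permutation.Setoid as SetoidPerm
import Data.List.Relation.Binary.Permutation.Setoid.Properties as SetoidPermₚ
open import Data.List.Relation.Binary.Pointwise as Pointwise using (Pointwise; []; _∷_)
open import Data.List.Relation.Unary.All using ([])
open import Data.List.Relation.Unary.AllPairs using ([]; _∷_)
open import Data.List.Relation.Unary.Any using (here; there)
open import Data.List.Relation.Unary.Unique.Propositional using (Unique; tail)
open import Data.List.Relation.Unary.Unique.Propositional.Properties
  using (Unique[x∷xs]⇒x∉xs)
open import Data.Nat.Base using (ℕ)
open import Data.Product.Base using (_×_; _,_; proj₁; proj₂; ∃-syntax; ∃₂)
open import Data.Sum.Base using (inj₁; inj₂)
open import Function.Base using (_∘_; id)
open import Function.Bundles using (_↣_)
open import Level using (0ℓ)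
import Relation.Binary.Construct.Closure.Equivalence as EqClosure
open import Relation.Binary.Construct.Closure.ReflexiveTransitive as Star
  using (Star; ε; _◅_; _◅◅_)
open import Relation.Binary.Construct.Closure.Symmetric using (fwd; bwd)
open import Relation.Binary.Core using (Rel; _⇒_)
open import Relation.Binary.Definitions using (DecidableEquality)
open import Relation.Binary.PropositionalEquality as ≡
  using (_≡_; _≢_; refl; cong; subst)
open import Relation.Binary.Rewriting using (IsNormalForm)
open import Relation.Nullary.Negation.Core using (¬_; contradiction)
open import Defs

module _ {Name : Set} where
  open πMLL Name

  open SetoidPerm (↭-setoid {A = Name × Type})
    using (prep; swap; trans; ↭-prep; ↭-swap)
    renaming ( refl to ≋⇒≃; ↭-refl to ≃-refl; ↭-sym to ≃-sym; ↭-trans to ≃-trans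
             ; ↭-reflexive to ≃-reflexive)
  private module ≃ₚ = SetoidPermₚ (↭-setoid {A = Name × Type})
  open import Data.List.Membership.Setoid (↭-setoid {A = Name × Type})
    using () renaming (_∈_ to _∈ₑ_)

  private variable
    x y z   : Name
    A B     : Type
    Γ Δ     : Env
    𝒢 ℋ 𝒢₁ 𝒢₂ : HyperEnv
    P Q R   : Proc
    Ps Qs   : List Proc

  -- Names of hyperenvironments and their distinctness.

  names : HyperEnv → List Name
  names 𝒢 = map proj₁ (concat 𝒢)

  names-++ : ∀ 𝒢 ℋ → names (𝒢 ++ ℋ) ≡ names 𝒢 ++ names ℋ
  names-++ 𝒢 ℋ = ≡.trans (cong (map proj₁) (≡.sym (concat-++ 𝒢 ℋ)))
    (map-++ proj₁ (concat 𝒢) (concat ℋ))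

  concat-≃ : 𝒢 ≃ ℋ → concat 𝒢 ↭ concat ℋ
  concat-≃ (≋⇒≃ [])                  = ↭.refl
  concat-≃ (≋⇒≃ (e ∷ es))            = ↭ₚ.++⁺ e (concat-≃ (≋⇒≃ es))
  concat-≃ (prep e p)                = ↭ₚ.++⁺ e (concat-≃ p)
  concat-≃ (swap {x = Γ} {Δ} e f p)  =
    ↭-trans (↭ₚ.shifts Γ Δ) (↭ₚ.++⁺ f (↭ₚ.++⁺ e (concat-≃ p)))
  concat-≃ (trans p q)               = ↭-trans (concat-≃ p) (concat-≃ q)

  names-≃ : 𝒢 ≃ ℋ → names 𝒢 ↭ names ℋ
  names-≃ p = ↭ₚ.map⁺ proj₁ (concat-≃ p)

  Unique-resp-↭ : ∀ {xs ys : List Name} → xs ↭ ys → Unique xs → Unique ys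
  Unique-resp-↭ p = SetoidPermₚ.Unique-resp-↭ (≡.setoid Name) (↭.↭⇒↭ₛ p)

  Distinct-resp-≃ : 𝒢 ≃ ℋ → Distinct 𝒢 → Distinct ℋ
  Distinct-resp-≃ p = Unique-resp-↭ (names-≃ p)

  Unique-++⁻ʳ : ∀ (xs : List Name) {ys} → Unique (xs ++ ys) → Unique ys
  Unique-++⁻ʳ []       u       = u
  Unique-++⁻ʳ (_ ∷ xs) (_ ∷ u) = Unique-++⁻ʳ xs u

  Distinct-++⁻ʳ : ∀ 𝒢 → Distinct (𝒢 ++ ℋ) → Distinct ℋ
  Distinct-++⁻ʳ {ℋ} 𝒢 = Unique-++⁻ʳ (names 𝒢) ∘ subst Unique (names-++ 𝒢 ℋ)

  Distinct-++⁻ˡ : ∀ 𝒢 → Distinct (𝒢 ++ ℋ) → Distinct 𝒢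
  Distinct-++⁻ˡ {ℋ} 𝒢 u = Distinct-++⁻ʳ ℋ (Distinct-resp-≃ (≃ₚ.++-comm 𝒢 ℋ) u)

  -- The derivation serves only to fix A, B, Γ and Δ, which names forgets.
  names-merge : ⊢ P ∷∷ ((x , A) ∷ Γ) ∷ ((y , B) ∷ Δ) ∷ 𝒢 →
    names (((x , A) ∷ Γ) ∷ ((y , B) ∷ Δ) ∷ 𝒢) ↭ x ∷ y ∷ names ((Γ ++ Δ) ∷ 𝒢)
  names-merge {x = x} {A} {Γ} {y} {B} {Δ} {𝒢} _ = ↭ₚ.map⁺ proj₁ (↭.prep (x , A)
    (↭-trans (↭ₚ.shift (y , B) Γ (Δ ++ concat 𝒢))
      (↭.prep (y , B) (↭-sym (↭ₚ.++-assoc Γ Δ (concat 𝒢))))))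

  ⊢⇒Distinct : ⊢ P ∷∷ 𝒢 → Distinct 𝒢
  ⊢⇒Distinct (t-cut d) =
    tail (tail (Unique-resp-↭ (names-merge d) (⊢⇒Distinct d)))
  ⊢⇒Distinct (t-par _ _ u)           = u
  ⊢⇒Distinct t-nil                   = []
  -- Only `y` is dropped; `x` stays at the head, with its new type.
  ⊢⇒Distinct (t-⊗ d)     =
    tail (Unique-resp-↭ (names-merge d) (⊢⇒Distinct d))
  ⊢⇒Distinct (t-one _)               = [] ∷ []
  ⊢⇒Distinct (t-⅋ d)                 = tail (⊢⇒Distinct d)
  ⊢⇒Distinct (t-bot _ u)             = u
  ⊢⇒Distinct (t-exch p d)            = Distinct-resp-≃ p (⊢⇒Distinct d)

  -- Free names of typed processes.

  ∈-∷⁻ : ∀ {xs} → z ≢ x → z ∈ x ∷ xs → z ∈ xs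
  ∈-∷⁻ z≢x (here z≡x) = contradiction z≡x z≢x
  ∈-∷⁻ z≢x (there i)  = i

  fn⇒names : ⊢ P ∷∷ 𝒢 → z ∈fn P → z ∈ names 𝒢
  fn⇒names (t-cut d) (z≢x , z≢y , i) =
    ∈-∷⁻ z≢y (∈-∷⁻ z≢x (↭ₚ.∈-resp-↭ (names-merge d) (fn⇒names d i)))
  fn⇒names (t-par {𝒢 = 𝒢} {ℋ} d e _) (inj₁ i) =
    subst (_ ∈_) (≡.sym (names-++ 𝒢 ℋ)) (∈-++⁺ˡ (fn⇒names d i))
  fn⇒names (t-par {𝒢 = 𝒢} {ℋ} d e _) (inj₂ i) =
    subst (_ ∈_) (≡.sym (names-++ 𝒢 ℋ)) (∈-++⁺ʳ (names 𝒢) (fn⇒names e i))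
  fn⇒names (t-⊗ d)     (inj₁ refl)      = here refl
  fn⇒names (t-⊗ d) (inj₂ (z≢y , i)) =
    ∈-∷⁻ z≢y (↭ₚ.∈-resp-↭ (names-merge d) (fn⇒names d i))
  fn⇒names (t-one d)   (inj₁ refl)      = here refl
  -- The body is typed by no environments, so it has no free names.
  fn⇒names (t-one d)   (inj₂ i)         = contradiction (fn⇒names d i) λ ()
  fn⇒names (t-⅋ d)     (inj₁ refl)      = here refl
  fn⇒names (t-⅋ d)     (inj₂ (z≢y , i)) = ∈-∷⁻ z≢y (fn⇒names d i)
  fn⇒names (t-bot d _) (inj₁ refl)      = here refl
  fn⇒names (t-bot d _) (inj₂ i)         = there (fn⇒names d i)
  fn⇒names (t-exch p d) i               = ↭ₚ.∈-resp-↭ (names-≃ p) (fn⇒names d i)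

  ∈-tail⇒≢ : ∀ {xs} → Unique (x ∷ xs) → z ∈ xs → z ≢ x
  ∈-tail⇒≢ u i refl = Unique[x∷xs]⇒x∉xs u i

  -- Distinctness handles the binders: a name that survives into the conclusion differs from the
  -- bound ones, because they stood together in the premise.
  names⇒fn : ⊢ P ∷∷ 𝒢 → z ∈ names 𝒢 → z ∈fn P
  names⇒fn (t-cut d) i =
    ∈-tail⇒≢ u (there i) , ∈-tail⇒≢ (tail u) i ,
    names⇒fn d (↭ₚ.∈-resp-↭ (↭-sym merge) (there (there i)))
    where
    merge = names-merge d
    u     = Unique-resp-↭ merge (⊢⇒Distinct d)
  names⇒fn (t-par {𝒢 = 𝒢} {ℋ} d e _) i with ∈-++⁻ (names 𝒢) (subst (_ ∈_) (names-++ 𝒢 ℋ) i)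
  ... | inj₁ j = inj₁ (names⇒fn d j)
  ... | inj₂ j = inj₂ (names⇒fn e j)
  names⇒fn (t-⊗ d) (here refl) = inj₁ refl
  names⇒fn (t-⊗ d) i@(there _) =
    inj₂ (∈-tail⇒≢ u i , names⇒fn d (↭ₚ.∈-resp-↭ (↭-sym merge) (there i)))
    where
    merge = names-merge d
    u     = Unique-resp-↭ merge (⊢⇒Distinct d)
  names⇒fn (t-one d)   (here refl)   = inj₁ refl
  names⇒fn (t-⅋ d)     (here refl)   = inj₁ refl
  names⇒fn (t-⅋ d)     (there i)     =
    inj₂ (∈-tail⇒≢ (⊢⇒Distinct d) (there i) , names⇒fn d (there (there i)))
  names⇒fn (t-bot d _) (here refl)   = inj₁ refl
  names⇒fn (t-bot d _) (there i)     = inj₂ (names⇒fn d i)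
  names⇒fn (t-exch p d) i            = names⇒fn d (↭ₚ.∈-resp-↭ (↭-sym (names-≃ p)) i)

  -- Provides the side condition of `scopeˡ`: the free names of `Q` are names of `𝒢`, and these are
  -- disjoint from `x` and `y` by distinctness.
  ∉fn-unrestricted :
    ⊢ P ∷∷ ((x , A) ∷ Γ) ∷ ((y , B) ∷ Δ) ∷ 𝒢 → ⊢ Q ∷∷ 𝒢 → x ∉fn Q × y ∉fn Q
  ∉fn-unrestricted {Γ = Γ} {Δ = Δ} {𝒢 = 𝒢} {Q} d e =
    (λ i → Unique[x∷xs]⇒x∉xs u (there (inject i))) ,
    (λ i → Unique[x∷xs]⇒x∉xs (tail u) (inject i))
    where
    u = Unique-resp-↭ (names-merge d) (⊢⇒Distinct d)
    inject : z ∈fn Q → z ∈ names ((Γ ++ Δ) ∷ 𝒢)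
    inject i = subst (_ ∈_) (≡.sym (names-++ [ Γ ++ Δ ] 𝒢))
      (∈-++⁺ʳ (names [ Γ ++ Δ ]) (fn⇒names e i))

  -- Splitting the typing of a parallel composition.

  ≃[]⇒≡[] : 𝒢 ≃ [] → 𝒢 ≡ []
  ≃[]⇒≡[] {[]}    _ = refl
  ≃[]⇒≡[] {_ ∷ _} p = contradiction p ≃ₚ.¬x∷xs↭[]

  ∈ₑ⇒≃∷ : Γ ∈ₑ 𝒢 → ∃[ ℋ ] 𝒢 ≃ Γ ∷ ℋ
  ∈ₑ⇒≃∷ (here e)              = _ , prep (↭-sym e) ≃-refl
  ∈ₑ⇒≃∷ {Γ} {Δ ∷ _} (there i) with ∈ₑ⇒≃∷ i
  ... | ℋ , p = Δ ∷ ℋ , ≃-trans (↭-prep Δ p) (↭-swap Δ Γ ≃-refl)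

  -- The name `x` locates its environment: it cannot come from `𝒢₂`, so it is found in `𝒢₁` and
  -- cancelled on both sides.
  ++-≃-∷⁻ : ∀ 𝒢₁ → x ∉ names 𝒢₂ → 𝒢₁ ++ 𝒢₂ ≃ ((x , A) ∷ Γ) ∷ ℋ →
            ∃[ 𝒢 ] (𝒢₁ ≃ ((x , A) ∷ Γ) ∷ 𝒢 × 𝒢 ++ 𝒢₂ ≃ ℋ)
  ++-≃-∷⁻ {𝒢₂ = 𝒢₂} 𝒢₁ x∉ p
    with SetoidMembershipₚ.∈-++⁻ ↭-setoid 𝒢₁ (≃ₚ.∈-resp-↭ (≃-sym p) (here ↭.refl))
  ... | inj₁ i = let 𝒢 , q = ∈ₑ⇒≃∷ i in
    𝒢 , q , ≃ₚ.drop-∷ (≃-trans (≃ₚ.++⁺ʳ 𝒢₂ (≃-sym q)) p)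
  ... | inj₂ i = contradiction
    (↭ₚ.∈-resp-↭ (↭-sym (names-≃ (proj₂ (∈ₑ⇒≃∷ i)))) (here refl)) x∉

  ⊢∥⁻ : ⊢ P ∥ Q ∷∷ 𝒢 → ∃₂ λ 𝒢₁ 𝒢₂ → ⊢ P ∷∷ 𝒢₁ × ⊢ Q ∷∷ 𝒢₂ × 𝒢₁ ++ 𝒢₂ ≃ 𝒢
  ⊢∥⁻ (t-par d e _) = _ , _ , d , e , ≃-refl
  ⊢∥⁻ (t-exch p d)  = let _ , _ , d₁ , d₂ , q = ⊢∥⁻ d in _ , _ , d₁ , d₂ , ≃-trans q p

  ⊢∥⁺ : ⊢ P ∷∷ 𝒢₁ → ⊢ Q ∷∷ 𝒢₂ → 𝒢₁ ++ 𝒢₂ ≃ 𝒢 → Distinct 𝒢 → ⊢ P ∥ Q ∷∷ 𝒢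
  ⊢∥⁺ d e p u = t-exch p (t-par d e (Distinct-resp-≃ (≃-sym p) u))

  -- Every name of the hyperenvironment of `Q` is free in `Q`, so both environments with a
  -- restricted name must come from `P`. This serves type preservation under scope laws as well as
  -- normality.
  ⊢∥⁻-scope : x ∉fn Q → y ∉fn Q → ⊢ P ∥ Q ∷∷ ((x , A) ∷ Γ) ∷ ((y , B) ∷ Δ) ∷ 𝒢 →
    ∃₂ λ 𝒢₁ 𝒢₂ → ⊢ P ∷∷ ((x , A) ∷ Γ) ∷ ((y , B) ∷ Δ) ∷ 𝒢₁ × ⊢ Q ∷∷ 𝒢₂ × 𝒢₁ ++ 𝒢₂ ≃ 𝒢
  ⊢∥⁻-scope x∉Q y∉Q d =
    let 𝒢₁  , 𝒢₂ , dP , dQ , p = ⊢∥⁻ d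
        𝒢₁′ , q , p′ = ++-≃-∷⁻ 𝒢₁  (x∉Q ∘ names⇒fn dQ) p
        𝒢₁″ , r , p″ = ++-≃-∷⁻ 𝒢₁′ (y∉Q ∘ names⇒fn dQ) p′
    in 𝒢₁″ , 𝒢₂ , t-exch (≃-trans q (↭-prep _ r)) dP , dQ , p″

  -- Type preservation.

  _⊑_ : Rel Proc 0ℓ
  P ⊑ Q = ∀ {𝒢} → ⊢ P ∷∷ 𝒢 → ⊢ Q ∷∷ 𝒢

  ∥-⊑-comm : (P ∥ Q) ⊑ (Q ∥ P)
  ∥-⊑-comm d = let 𝒢₁ , 𝒢₂ , dP , dQ , p = ⊢∥⁻ d in
    ⊢∥⁺ dQ dP (≃-trans (≃ₚ.++-comm 𝒢₂ 𝒢₁) p) (⊢⇒Distinct d)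

  ∥-⊑ : ∀ {P P′ Q Q′} → P ⊑ P′ → Q ⊑ Q′ → (P ∥ Q) ⊑ (P′ ∥ Q′)
  ∥-⊑ f g d = let _ , _ , dP , dQ , p = ⊢∥⁻ d in ⊢∥⁺ (f dP) (g dQ) p (⊢⇒Distinct d)

  AC⇒⊑ : AC P Q → P ⊑ Q
  AC⇒⊑ comm  d = ∥-⊑-comm d
  AC⇒⊑ assoc d =
    let 𝒢₁₂ , 𝒢₃ , d₁₂ , d₃ , p = ⊢∥⁻ d
        𝒢₁ , 𝒢₂ , d₁ , d₂ , q   = ⊢∥⁻ d₁₂
        r = ≃-trans (≃-sym (≃ₚ.++-assoc 𝒢₁ 𝒢₂ 𝒢₃)) (≃-trans (≃ₚ.++⁺ʳ 𝒢₃ q) p)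
        u = Distinct-resp-≃ (≃-sym r) (⊢⇒Distinct d)
    in ⊢∥⁺ d₁ (t-par d₂ d₃ (Distinct-++⁻ʳ 𝒢₁ u)) r (⊢⇒Distinct d)

  ⊢𝟎⇒≡[] : ⊢ 𝟎 ∷∷ 𝒢 → 𝒢 ≡ []
  ⊢𝟎⇒≡[] t-nil        = refl
  ⊢𝟎⇒≡[] (t-exch p d) with refl ← ⊢𝟎⇒≡[] d = ≃[]⇒≡[] (≃-sym p)

  scopeˡ-⊑ : x ∉fn Q → y ∉fn Q → ν x y (P ∥ Q) ⊑ (ν x y P ∥ Q)
  scopeˡ-⊑ x∉Q y∉Q c@(t-cut d) = let _ , _ , dP , dQ , p = ⊢∥⁻-scope x∉Q y∉Q d in
    ⊢∥⁺ (t-cut dP) dQ (↭-prep _ p) (⊢⇒Distinct c)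
  scopeˡ-⊑ x∉Q y∉Q (t-exch p d) = t-exch p (scopeˡ-⊑ x∉Q y∉Q d)

  ν-⊑ : P ⊑ Q → ν x y P ⊑ ν x y Q
  ν-⊑ f (t-cut d)    = t-cut (f d)
  ν-⊑ f (t-exch p d) = t-exch p (ν-⊑ f d)

  Law⇒⊑ : Law P Q → P ⊑ Q
  Law⇒⊑ unit d with ⊢∥⁻ d
  ... | 𝒢₁ , _ , dP , d𝟎 , p with refl ← ⊢𝟎⇒≡[] d𝟎 =
    t-exch (≃-trans (≃-reflexive (≡.sym (++-identityʳ 𝒢₁))) p) dP
  Law⇒⊑ (scopeˡ x∉Q y∉Q) d = scopeˡ-⊑ x∉Q y∉Q d
  -- Reduced to `scopeˡ` by commuting the factors under the restriction and commuting back outside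
  -- it.
  Law⇒⊑ (scopeʳ x∉P y∉P) d = ∥-⊑-comm (scopeˡ-⊑ x∉P y∉P (ν-⊑ ∥-⊑-comm d))

  Compatible⇒⊑ : ∀ {R : Rel Proc 0ℓ} → (∀ {P Q} → R P Q → P ⊑ Q) →
                 ∀ {P Q} → Compatible R P Q → P ⊑ Q
  Compatible⇒⊑ f (here r) d            = f r d
  Compatible⇒⊑ f (out c)  (t-⊗ d)      = t-⊗ (Compatible⇒⊑ f c d)
  Compatible⇒⊑ f (inp c)  (t-⅋ d)      = t-⅋ (Compatible⇒⊑ f c d)
  Compatible⇒⊑ f (out₀ c) (t-one d)    = t-one (Compatible⇒⊑ f c d)
  Compatible⇒⊑ f (inp₀ c) (t-bot d u)  = t-bot (Compatible⇒⊑ f c d) u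
  Compatible⇒⊑ f (res c)  d            = ν-⊑ (Compatible⇒⊑ f c) d
  Compatible⇒⊑ f (parˡ c) d            = ∥-⊑ (Compatible⇒⊑ f c) id d
  Compatible⇒⊑ f (parʳ c) d            = ∥-⊑ id (Compatible⇒⊑ f c) d
  Compatible⇒⊑ f c        (t-exch p d) = t-exch p (Compatible⇒⊑ f c d)

  -- Inverse steps are themselves sequences of forward steps, so an invariant of `≈ᵃᶜ` need only be
  -- checked in the forward direction.
  AC-sym : AC P Q → Star (Compatible AC) Q P
  AC-sym comm  = here comm ◅ ε
  -- The factors rotate: P(QR), (QR)P, Q(RP), (RP)Q, R(PQ), (PQ)R.
  AC-sym assoc = here comm ◅ here assoc ◅ here comm ◅ here assoc ◅ here comm ◅ ε

  Compatible-AC-sym : Compatible AC P Q → Star (Compatible AC) Q P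
  Compatible-AC-sym (here r) = AC-sym r
  Compatible-AC-sym (out c)  = Star.gmap _ out  (Compatible-AC-sym c)
  Compatible-AC-sym (inp c)  = Star.gmap _ inp  (Compatible-AC-sym c)
  Compatible-AC-sym (out₀ c) = Star.gmap _ out₀ (Compatible-AC-sym c)
  Compatible-AC-sym (inp₀ c) = Star.gmap _ inp₀ (Compatible-AC-sym c)
  Compatible-AC-sym (res c)  = Star.gmap _ res  (Compatible-AC-sym c)
  Compatible-AC-sym (parˡ c) = Star.gmap _ parˡ (Compatible-AC-sym c)
  Compatible-AC-sym (parʳ c) = Star.gmap _ parʳ (Compatible-AC-sym c)

  ≈ᵃᶜ⇒Star : P ≈ᵃᶜ Q → Star (Compatible AC) P Q
  ≈ᵃᶜ⇒Star = Star.kleisliStar id λ where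
    (fwd c) → c ◅ ε
    (bwd c) → Compatible-AC-sym c

  ≈ᵃᶜ⇒⊑ : P ≈ᵃᶜ Q → P ⊑ Q
  ≈ᵃᶜ⇒⊑ e = Star.fold _⊑_ (λ c g → g ∘ Compatible⇒⊑ AC⇒⊑ c) id (≈ᵃᶜ⇒Star e)

  ⟶⇒⊑ : P ⟶ Q → P ⊑ Q
  ⟶⇒⊑ (_ , _ , e , c , e′) = ≈ᵃᶜ⇒⊑ e′ ∘ Compatible⇒⊑ Law⇒⊑ c ∘ ≈ᵃᶜ⇒⊑ e

  ⟶*⇒⊑ : Star _⟶_ P Q → P ⊑ Q
  ⟶*⇒⊑ = Star.fold _⊑_ (λ s g → g ∘ ⟶⇒⊑ s) id

  -- Reduction modulo associativity and commutativity, and products.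

  Compatible-map : ∀ {R S : Rel Proc 0ℓ} → R ⇒ S → Compatible R ⇒ Compatible S
  Compatible-map f (here r) = here (f r)
  Compatible-map f (out c)  = out  (Compatible-map f c)
  Compatible-map f (inp c)  = inp  (Compatible-map f c)
  Compatible-map f (out₀ c) = out₀ (Compatible-map f c)
  Compatible-map f (inp₀ c) = inp₀ (Compatible-map f c)
  Compatible-map f (res c)  = res  (Compatible-map f c)
  Compatible-map f (parˡ c) = parˡ (Compatible-map f c)
  Compatible-map f (parʳ c) = parʳ (Compatible-map f c)

  ≈ᵃᶜ-sym : P ≈ᵃᶜ Q → Q ≈ᵃᶜ P
  ≈ᵃᶜ-sym = EqClosure.symmetric _

  AC⇒≈ᵃᶜ : AC P Q → P ≈ᵃᶜ Q
  AC⇒≈ᵃᶜ r = EqClosure.return (here r)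

  ∥-≈ᵃᶜ : ∀ {P P′ Q Q′} → P ≈ᵃᶜ P′ → Q ≈ᵃᶜ Q′ → (P ∥ Q) ≈ᵃᶜ (P′ ∥ Q′)
  ∥-≈ᵃᶜ e f = EqClosure.gmap (_∥ _) parˡ e ◅◅ EqClosure.gmap (_ ∥_) parʳ f

  ≈ᵃᶜ⇒≈ : P ≈ᵃᶜ Q → P ≈ Q
  ≈ᵃᶜ⇒≈ = EqClosure.map (Compatible-map ac)

  Law⇒⟶ : Law P Q → P ⟶ Q
  Law⇒⟶ r = _ , _ , ε , here r , ε

  infix 4 _⇛_

  -- The trailing equivalence is needed because an empty reduction sequence cannot absorb a
  -- rearrangement of factors.
  _⇛_ : Rel Proc 0ℓ
  P ⇛ R = ∃[ Q ] (Star _⟶_ P Q × Q ≈ᵃᶜ R)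

  ≈ᵃᶜ⇒⇛ : P ≈ᵃᶜ Q → P ⇛ Q
  ≈ᵃᶜ⇒⇛ e = _ , ε , e

  ⟶⇒⇛ : P ⟶ Q → P ⇛ Q
  ⟶⇒⇛ s = _ , s ◅ ε , ε

  ⇛-trans : P ⇛ Q → Q ⇛ R → P ⇛ R
  ⇛-trans (_ , ss , e) (_ , ε , e′) = _ , ss , e ◅◅ e′
  -- The pending equivalence `e` is absorbed into the source side of the next step.
  ⇛-trans (_ , ss , e) (_ , (_ , _ , f , c , f′) ◅ ts , e′) =
    _ , ss ◅◅ (_ , _ , e ◅◅ f , c , f′) ◅ ts , e′

  ⇛-cong : (F : Proc → Proc) → (∀ {R P Q} → Compatible R P Q → Compatible R (F P) (F Q)) →
           P ⇛ Q → F P ⇛ F Q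
  ⇛-cong F k (Q , ss , e) = F Q , Star.gmap F step ss , EqClosure.gmap F k e
    where
    step : ∀ {P Q} → P ⟶ Q → F P ⟶ F Q
    step (_ , _ , f , c , f′) = _ , _ , EqClosure.gmap F k f , k c , EqClosure.gmap F k f′

  -- Unlike ∏, with no trailing 𝟎, which is a redex modulo associativity and commutativity.
  ∏⁺ : List Proc → Proc
  ∏⁺ []           = 𝟎
  ∏⁺ (P ∷ [])     = P
  ∏⁺ (P ∷ Q ∷ Ps) = P ∥ ∏⁺ (Q ∷ Ps)

  ∏⁺-≈-∏ : ∀ Ps → ∏⁺ Ps ≈ ∏ Ps
  ∏⁺-≈-∏ []           = ε
  ∏⁺-≈-∏ (P ∷ [])     = EqClosure.symmetric _ (EqClosure.return (here unit))
  ∏⁺-≈-∏ (P ∷ Q ∷ Ps) = EqClosure.gmap (P ∥_) parʳ (∏⁺-≈-∏ (Q ∷ Ps))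

  ∏⁺-++ : ∀ Ps Qs → ∏⁺ Ps ∥ ∏⁺ Qs ⇛ ∏⁺ (Ps ++ Qs)
  -- The law erases only a right unit, so `𝟎` is first moved to the right.
  ∏⁺-++ []           Qs       = ⇛-trans (≈ᵃᶜ⇒⇛ (AC⇒≈ᵃᶜ comm)) (⟶⇒⇛ (Law⇒⟶ unit))
  ∏⁺-++ (P ∷ [])     []       = ⟶⇒⇛ (Law⇒⟶ unit)
  ∏⁺-++ (P ∷ [])     (_ ∷ _)  = ≈ᵃᶜ⇒⇛ ε
  ∏⁺-++ (P ∷ Q ∷ Ps) Qs       =
    ⇛-trans (≈ᵃᶜ⇒⇛ (AC⇒≈ᵃᶜ assoc)) (⇛-cong (P ∥_) parʳ (∏⁺-++ (Q ∷ Ps) Qs))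

  -- The shape of `∏⁺` depends on whether the tail is empty; permutation preserves this, so the
  -- mixed cases are void.
  ∏⁺-↭ : Ps ↭ Qs → ∏⁺ Ps ≈ᵃᶜ ∏⁺ Qs
  ∏⁺-↭ ↭.refl = ε
  ∏⁺-↭ (↭.prep {[]} {[]} _ p)       = ε
  ∏⁺-↭ (↭.prep {_ ∷ _} {_ ∷ _} _ p) = ∥-≈ᵃᶜ ε (∏⁺-↭ p)
  ∏⁺-↭ (↭.prep {[]} {_ ∷ _} _ p)    = contradiction (↭-sym p) ↭ₚ.¬x∷xs↭[]
  ∏⁺-↭ (↭.prep {_ ∷ _} {[]} _ p)    = contradiction p ↭ₚ.¬x∷xs↭[]
  ∏⁺-↭ (↭.swap {[]} {[]} _ _ p)     = AC⇒≈ᵃᶜ comm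
  ∏⁺-↭ (↭.swap {_ ∷ _} {_ ∷ _} _ _ p) =
    ≈ᵃᶜ-sym (AC⇒≈ᵃᶜ assoc) ◅◅ ∥-≈ᵃᶜ (AC⇒≈ᵃᶜ comm) (∏⁺-↭ p) ◅◅ AC⇒≈ᵃᶜ assoc
  ∏⁺-↭ (↭.swap {[]} {_ ∷ _} _ _ p)  = contradiction (↭-sym p) ↭ₚ.¬x∷xs↭[]
  ∏⁺-↭ (↭.swap {_ ∷ _} {[]} _ _ p)  = contradiction p ↭ₚ.¬x∷xs↭[]
  ∏⁺-↭ (↭.trans p q)                = ∏⁺-↭ p ◅◅ ∏⁺-↭ q

  -- Syntactic normal forms.

  -- The typing premise of nf-res says that the body of a restriction consists of exactly
  -- two components, one for each restricted name.
  data Nf : Proc → Set where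
    nf-out  : Nf P → Nf (x [ y ]∙ P)
    nf-inp  : Nf P → Nf (x ⟨ y ⟩∙ P)
    nf-out₀ : Nf P → Nf (x []∙ P)
    nf-inp₀ : Nf P → Nf (x ⟨⟩∙ P)
    nf-res  : Nf P → ⊢ P ∷∷ ((x , A) ∷ Γ) ∷ [ (y , B) ∷ Δ ] → Nf (ν x y P)
    nf-par  : Nf P → Nf Q → P ≢ 𝟎 → Q ≢ 𝟎 → Nf (P ∥ Q)
    nf-nil  : Nf 𝟎

  Compatible-AC⇒≢𝟎 : Compatible AC P Q → Q ≢ 𝟎
  Compatible-AC⇒≢𝟎 (here ()) refl

  Nf-Compatible-AC : Compatible AC P Q → Nf P → Nf Q
  Nf-Compatible-AC (here comm)  (nf-par p q p≢ q≢) = nf-par q p q≢ p≢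
  Nf-Compatible-AC (here assoc) (nf-par (nf-par p q p≢ q≢) r _ r≢) =
    nf-par p (nf-par q r q≢ r≢) p≢ λ ()
  Nf-Compatible-AC (out c)  (nf-out p)   = nf-out (Nf-Compatible-AC c p)
  Nf-Compatible-AC (inp c)  (nf-inp p)   = nf-inp (Nf-Compatible-AC c p)
  Nf-Compatible-AC (out₀ c) (nf-out₀ p)  = nf-out₀ (Nf-Compatible-AC c p)
  Nf-Compatible-AC (inp₀ c) (nf-inp₀ p)  = nf-inp₀ (Nf-Compatible-AC c p)
  Nf-Compatible-AC (res c)  (nf-res p d) =
    nf-res (Nf-Compatible-AC c p) (Compatible⇒⊑ AC⇒⊑ c d)
  Nf-Compatible-AC (parˡ c) (nf-par p q _ q≢) =
    nf-par (Nf-Compatible-AC c p) q (Compatible-AC⇒≢𝟎 c) q≢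
  Nf-Compatible-AC (parʳ c) (nf-par p q p≢ _) =
    nf-par p (Nf-Compatible-AC c q) p≢ (Compatible-AC⇒≢𝟎 c)

  Nf-≈ᵃᶜ : P ≈ᵃᶜ Q → Nf P → Nf Q
  Nf-≈ᵃᶜ e = Star.fold (λ P Q → Nf P → Nf Q) (λ c g → g ∘ Nf-Compatible-AC c) id (≈ᵃᶜ⇒Star e)

  -- Apart from exchange, only `t-nil` and `t-par` can conclude with no environments, and the
  -- factors of the latter would both be `𝟎`, against `nf-par`. The separate equation allows
  -- matching on `t-par`, whose index is a concatenation.
  Nf-⊢[]⇒≡𝟎 : Nf P → 𝒢 ≡ [] → ⊢ P ∷∷ 𝒢 → P ≡ 𝟎
  Nf-⊢[]⇒≡𝟎 (nf-par p _ p≢ _) eq (t-par {𝒢 = 𝒢} {ℋ} d _ _) =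
    contradiction (Nf-⊢[]⇒≡𝟎 p (++-conicalˡ 𝒢 ℋ eq) d) p≢
  Nf-⊢[]⇒≡𝟎 _ eq t-nil           = refl
  Nf-⊢[]⇒≡𝟎 p refl (t-exch q d)  = Nf-⊢[]⇒≡𝟎 p (≃[]⇒≡[] q) d

  -- Once `P` has claimed both environments, none is left for `Q`.
  Nf-¬scope : Nf Q → Q ≢ 𝟎 → x ∉fn Q → y ∉fn Q →
              ¬ (⊢ P ∥ Q ∷∷ ((x , A) ∷ Γ) ∷ [ (y , B) ∷ Δ ])
  Nf-¬scope q q≢ x∉Q y∉Q d = let 𝒢₁ , 𝒢₂ , _ , dQ , p = ⊢∥⁻-scope x∉Q y∉Q d in
    q≢ (Nf-⊢[]⇒≡𝟎 q (++-conicalʳ 𝒢₁ 𝒢₂ (≃[]⇒≡[] p)) dQ)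

  Nf-¬Law : Nf P → ¬ Compatible Law P Q
  Nf-¬Law (nf-par _ _ _ q≢) (here unit) = q≢ refl
  Nf-¬Law (nf-res (nf-par _ q _ q≢) d) (here (scopeˡ x∉ y∉)) = Nf-¬scope q q≢ x∉ y∉ d
  Nf-¬Law (nf-res (nf-par p _ p≢ _) d) (here (scopeʳ x∉ y∉)) =
    Nf-¬scope p p≢ x∉ y∉ (∥-⊑-comm d)
  Nf-¬Law (nf-out p)       (out c)  = Nf-¬Law p c
  Nf-¬Law (nf-inp p)       (inp c)  = Nf-¬Law p c
  Nf-¬Law (nf-out₀ p)      (out₀ c) = Nf-¬Law p c
  Nf-¬Law (nf-inp₀ p)      (inp₀ c) = Nf-¬Law p c
  Nf-¬Law (nf-res p _)     (res c)  = Nf-¬Law p c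
  Nf-¬Law (nf-par p _ _ _) (parˡ c) = Nf-¬Law p c
  Nf-¬Law (nf-par _ q _ _) (parʳ c) = Nf-¬Law q c

  Nf⇒IsNormalForm : Nf P → IsNormalForm _⟶_ P
  Nf⇒IsNormalForm p (_ , _ , _ , e , c , _) = Nf-¬Law (Nf-≈ᵃᶜ e p) c

  -- Disentangling a typed process.

  Component : Proc → Env → Set
  Component P Γ = ⊢ P ∷∷ [ Γ ] × Nf P

  -- Permuting environments reorders the components; permuting entries inside one is absorbed by
  -- exchange.
  Pointwise-resp-≃ : Pointwise Component Ps 𝒢 → 𝒢 ≃ ℋ →
                     ∃[ Qs ] (Ps ↭ Qs × Pointwise Component Qs ℋ)
  Pointwise-resp-≃ cs (≋⇒≃ es) = _ , ↭.refl ,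
    Pointwise.transitive (λ (d , p) e → t-exch (prep e ≃-refl) d , p) cs es
  Pointwise-resp-≃ ((d , p) ∷ cs) (prep e q) = let _ , r , cs′ = Pointwise-resp-≃ cs q in
    _ , ↭.prep _ r , (t-exch (prep e ≃-refl) d , p) ∷ cs′
  Pointwise-resp-≃ ((d₁ , p₁) ∷ (d₂ , p₂) ∷ cs) (swap e₁ e₂ q) =
    let _ , r , cs′ = Pointwise-resp-≃ cs q in
    _ , ↭.swap _ _ r ,
    (t-exch (prep e₂ ≃-refl) d₂ , p₂) ∷ (t-exch (prep e₁ ≃-refl) d₁ , p₁) ∷ cs′
  Pointwise-resp-≃ cs (trans q q′) =
    let _ , r , cs′  = Pointwise-resp-≃ cs q
        _ , r′ , cs″ = Pointwise-resp-≃ cs′ q′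
    in _ , ↭-trans r r′ , cs″

  ⊢-∏⁺ : Pointwise Component Ps 𝒢 → Distinct 𝒢 → ⊢ ∏⁺ Ps ∷∷ 𝒢
  ⊢-∏⁺ []                      _ = t-nil
  ⊢-∏⁺ ((d , _) ∷ [])          _ = d
  ⊢-∏⁺ {𝒢 = Γ ∷ 𝒢} ((d , _) ∷ cs@(_ ∷ _)) u =
    t-par d (⊢-∏⁺ cs (Distinct-++⁻ʳ {𝒢} [ Γ ] u)) u

  ⊢∷⇒≢𝟎 : ⊢ P ∷∷ Γ ∷ 𝒢 → P ≢ 𝟎
  ⊢∷⇒≢𝟎 d refl with () ← ⊢𝟎⇒≡[] d

  Nf-∏⁺ : Pointwise Component Ps 𝒢 → Nf (∏⁺ Ps)
  Nf-∏⁺ []                                = nf-nil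
  Nf-∏⁺ ((_ , p) ∷ [])                    = p
  Nf-∏⁺ ((d , p) ∷ cs@((e , _) ∷ []))     = nf-par p (Nf-∏⁺ cs) (⊢∷⇒≢𝟎 d) (⊢∷⇒≢𝟎 e)
  Nf-∏⁺ ((d , p) ∷ cs@(_ ∷ _ ∷ _))        = nf-par p (Nf-∏⁺ cs) (⊢∷⇒≢𝟎 d) λ ()

  Disentangled : Proc → HyperEnv → Set
  Disentangled P 𝒢 = ∃[ Ps ] (P ⇛ ∏⁺ Ps × Pointwise Component Ps 𝒢)

  disentangle : ⊢ P ∷∷ 𝒢 → Disentangled P 𝒢

  -- The common case of all four prefixes. `𝒢` is arbitrary since the premise has two environments
  -- for `t-⊗` and none for `t-one`.
  prefix : (F : Proc → Proc) → (∀ {R P Q} → Compatible R P Q → Compatible R (F P) (F Q)) →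
           (∀ {P} → Nf P → Nf (F P)) → (∀ {Q} → ⊢ Q ∷∷ 𝒢 → ⊢ F Q ∷∷ [ Γ ]) →
           ⊢ P ∷∷ 𝒢 → Disentangled (F P) [ Γ ]
  prefix F k nf t d = let Ps , s , cs = disentangle d in
    F (∏⁺ Ps) ∷ [] , ⇛-cong F k s , (t (⊢-∏⁺ cs (⊢⇒Distinct d)) , nf (Nf-∏⁺ cs)) ∷ []

  disentangle (t-cut {x} {y} {A} {_} {Γ} {Δ} {𝒢} d) with disentangle d
  -- No third component: the restriction already has its final scope.
  ... | P ∷ Q ∷ [] , s , cs@(_ ∷ _ ∷ []) =
    let d′ = ⊢-∏⁺ cs (⊢⇒Distinct d) in
    _ ∷ [] , ⇛-cong (ν _ _) res s , (t-cut d′ , nf-res (Nf-∏⁺ cs) d′) ∷ []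
  ... | P ∷ Q ∷ Ps@(_ ∷ _) , s , c₁ ∷ c₂ ∷ cs =
    let Γs = ((x , A) ∷ Γ) ∷ [ (y , A ^⊥) ∷ Δ ]
        u  = ⊢⇒Distinct d
        d′ = ⊢-∏⁺ (c₁ ∷ c₂ ∷ []) (Distinct-++⁻ˡ {𝒢} Γs u)
        e  = ⊢-∏⁺ cs (Distinct-++⁻ʳ {𝒢} Γs u)
        x∉ , y∉ = ∉fn-unrestricted d e
    in _ ∷ Ps ,
       -- Reassociating groups `P ∥ Q` against the remaining product, which a single `scopeˡ` then
       -- expels whole.
       ⇛-trans (⇛-cong (ν _ _) res (⇛-trans s (≈ᵃᶜ⇒⇛ (≈ᵃᶜ-sym (AC⇒≈ᵃᶜ assoc)))))
               (⟶⇒⇛ (Law⇒⟶ (scopeˡ x∉ y∉))) ,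
       (t-cut d′ , nf-res (Nf-∏⁺ (c₁ ∷ c₂ ∷ [])) d′) ∷ cs
  disentangle (t-par d e _) =
    let Ps , s , cs = disentangle d
        Qs , t , ds = disentangle e
    in Ps ++ Qs ,
       ⇛-trans (⇛-cong (_∥ _) parˡ s) (⇛-trans (⇛-cong (_ ∥_) parʳ t) (∏⁺-++ Ps Qs)) ,
       Pointwise.++⁺ cs ds
  disentangle t-nil        = [] , ≈ᵃᶜ⇒⇛ ε , []
  disentangle (t-⊗ d)      = prefix (_ [ _ ]∙_) out nf-out t-⊗ d
  disentangle (t-one d)    = prefix (_ []∙_) out₀ nf-out₀ t-one d
  disentangle (t-⅋ d)      = prefix (_ ⟨ _ ⟩∙_) inp nf-inp t-⅋ d
  disentangle (t-bot d u)  = prefix (_ ⟨⟩∙_) inp₀ nf-inp₀ (λ e → t-bot e u) d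
  disentangle (t-exch p d) =
    let Ps , s , cs  = disentangle d
        Qs , r , cs′ = Pointwise-resp-≃ cs p
    in Qs , ⇛-trans s (≈ᵃᶜ⇒⇛ (∏⁺-↭ r)) , cs′

lemma3p30 : (Name : Set) → DecidableEquality Name → (ℕ ↣ Name) →
    let open πMLL Name in
    ∀ (P : Proc) (Γs : HyperEnv) → ⊢ P ∷∷ Γs →
    (∃[ Q ] Dis P Q) ×
    (∀ Q → Dis P Q →
    ∃[ Ps ] (Q ≈ ∏ Ps × Pointwise (λ Pᵢ Γᵢ → ⊢ Pᵢ ∷∷ [ Γᵢ ]) Ps Γs))
lemma3p30 Name _ _ P Γs d = existence , components
  where
  open πMLL Name

  existence : ∃[ Q ] Dis P Q
  existence = let _ , (Q , ss , e) , cs = disentangle d in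
    Q , ss , Nf⇒IsNormalForm (Nf-≈ᵃᶜ (≈ᵃᶜ-sym e) (Nf-∏⁺ cs))

  components : ∀ Q → Dis P Q →
    ∃[ Ps ] (Q ≈ ∏ Ps × Pointwise (λ Pᵢ Γᵢ → ⊢ Pᵢ ∷∷ [ Γᵢ ]) Ps Γs)
  components Q (ss , nf) with disentangle (⟶*⇒⊑ ss d)
  ... | _  , (_ , s ◅ _ , _) , _  = contradiction (_ , s) nf
  -- The unit enters `≈` only for the trailing `𝟎` of `∏`.
  ... | Ps , (_ , ε , e)     , cs = Ps , ≈ᵃᶜ⇒≈ e ◅◅ ∏⁺-≈-∏ Ps , Pointwise.map proj₁ cs
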